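{- Let $r,s$ be nonzero integers, let $m\ge 1$ be an integer, let $l\in\{0,1,\dots,m-1\}$, and put $y=\frac{r}{\sqrt{ -s}}$. Then the ordinary generating function $$GSml(r,s;m,l;x):=\sum_{n=0}^{\infty}S\!\left(mn+l,\,y\right)x^n$$ satisfies, as formal power series in $x$, $$GSml(r,s;m,l;x)=\frac{1}{(\sqrt{ -s})^{l}}\,GH01ml\!\left(r,s;m,l+1;\frac{x}{(\sqrt{ -s})^{m}}\right)=\frac{S(l,y)-\bigl(S(l,y)\,R(m,y)-S(m+l,y)\bigr)x}{1-R(m,y)\,x+x^2}.$$
   Context: $\sqrt{\cdot}$ denotes the principal complex square root (so $\sqrt{ -s}=i\sqrt{s}$ if $s>0$). The Chebyshev $S$-polynomials are defined by $S(0,x)=1$, $S(1,x)=x$, $S(n,x)=x\,S(n-1,x)-S(n-2,x)$ for $n\ge 2$, and are extended by $S(-1,x)=0$ and $S(n,x)=-S(-n-2,x)$ for $n\le -2$ (so $S(-2,x)=-1$). The $R$-polynomials (monic Chebyshev $T$-polynomials) are $R(n,x):=S(n,x)-S(n-2,x)$ for $n\ge 0$. The sequence $H01(r,s;n)$ is defined by $H01(r,s;0)=0$, $H01(r,s;1)=1$, $H01(r,s;n)=r\,H01(r,s;n-1)+s\,H01(r,s;n-2)$ for $n\ge 2$. For an integer $k\ge 0$, $GH01ml(r,s;m,k;x):=\sum_{n=0}^{\infty}H01(r,s;mn+k)\,x^n$. -}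

module Defs where

open import Level using (0ℓ)
open import Algebra.Bundles using (CommutativeRing; Semiring)
open import Algebra.Structures using (IsCommutativeRing)
import Algebra.Consequences.Setoid as Consequences
import Algebra.Definitions as AlgebraDefinitions
import Algebra.Definitions.RawMonoid as RawMonoidDefinitions
import Algebra.Definitions.RawSemiring as RawSemiringDefinitions
import Algebra.Properties.AbelianGroup as AbelianGroupProperties
import Algebra.Properties.CommutativeSemigroup as CommutativeSemigroupProperties
import Algebra.Properties.Ring as RingProperties
open import Data.Fin as Fin using (Fin)
open import Data.Integer as ℤ using (ℤ; +_; -[1+_]; 0ℤ)
import Data.Integer.Properties as ℤ
open import Data.List using (List; []; _∷_)
open import Data.Nat as ℕ using (ℕ; zero; suc; z≤n; s≤s)
import Data.Nat.Properties as ℕ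
open import Data.Product using (∃; _×_; _,_; proj₁; proj₂)
open import Data.Rational as ℚ using (ℚ; 0ℚ; 1ℚ; ½; mkℚ; *<*)
open import Data.Rational.Literals using (fromℤ)
import Data.Rational.Properties as ℚ
open import Data.Rational.Unnormalised as ℚᵘ using (mkℚᵘ; *≡*; *<*; *≤*)
import Data.Rational.Unnormalised.Properties as ℚᵘ
open import Data.Sum using (_⊎_; inj₁; inj₂)
open import Relation.Binary using (IsEquivalence; Setoid)
import Relation.Binary.Reasoning.Setoid as SetoidReasoning
open import Relation.Binary.PropositionalEquality
  using (_≡_; _≢_; refl; sym; trans; cong; cong₂; subst; subst₂)
open import Relation.Nullary using (yes; no; ¬_; contradiction)

private
  module Differences (K : CommutativeRing 0ℓ 0ℓ) where
    open CommutativeRing K renaming (sym to ≈-sym; trans to ≈-trans)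
    open RingProperties ring using (x[y-z]≈xy-xz)
    open AbelianGroupProperties +-abelianGroup using (⁻¹-∙-comm)
    open CommutativeSemigroupProperties +-commutativeSemigroup using (interchange)
    open SetoidReasoning setoid

    diff-+ : ∀ a b c d → (a - b) + (c - d) ≈ (a + c) - (b + d)
    diff-+ a b c d = ≈-trans (interchange a (- b) c (- d)) (+-congˡ (⁻¹-∙-comm b d))

    diff-neg : ∀ a b → - (a - b) ≈ - a - - b
    diff-neg a b = ≈-sym (⁻¹-∙-comm a (- b))

    diff-trans : ∀ a b c → (a - b) + (b - c) ≈ a - c
    diff-trans a b c = begin
      (a - b) + (b - c)     ≈⟨ +-assoc a (- b) (b - c) ⟩
      a + (- b + (b - c))   ≈⟨ +-congˡ (+-assoc (- b) b (- c)) ⟨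
      a + ((- b + b) - c)   ≈⟨ +-congˡ (+-congʳ (-‿inverseˡ b)) ⟩
      a + (0# - c)          ≈⟨ +-congˡ (+-identityˡ (- c)) ⟩
      a - c                 ∎

    diff-* : ∀ a b c d → a * (c - d) + d * (a - b) ≈ a * c - b * d
    diff-* a b c d = begin
      a * (c - d) + d * (a - b)           ≈⟨ +-cong (x[y-z]≈xy-xz a c d) (x[y-z]≈xy-xz d a b) ⟩
      (a * c - a * d) + (d * a - d * b)   ≈⟨ +-congˡ (+-cong (*-comm d a) (-‿cong (*-comm d b))) ⟩
      (a * c - a * d) + (a * d - b * d)   ≈⟨ diff-trans _ _ _ ⟩
      a * c - b * d                       ∎

    diff-shuffle : ∀ p q r s → (p - q) - (r + s) ≈ (p - r) - (s + q)
    diff-shuffle p q r s = begin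
      (p - q) - (r + s)       ≈⟨ +-congˡ (⁻¹-∙-comm r s) ⟨
      (p - q) + (- r - s)     ≈⟨ interchange p (- q) (- r) (- s) ⟩
      (p - r) + (- q - s)     ≈⟨ +-congˡ (+-comm (- q) (- s)) ⟩
      (p - r) + (- s - q)     ≈⟨ +-congˡ (⁻¹-∙-comm s q) ⟩
      (p - r) - (s + q)       ∎

    sum-shuffle : ∀ p q r s → (p - q) + (r + s) ≈ (p + r) + (s - q)
    sum-shuffle p q r s = ≈-trans (interchange p (- q) r s) (+-congˡ (+-comm (- q) s))

  module ℚΔ where
    private module Δ = Differences ℚ.+-*-commutativeRing

    diff-+ : ∀ a b c d → (a ℚ.- b) ℚ.+ (c ℚ.- d) ≡ (a ℚ.+ c) ℚ.- (b ℚ.+ d)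
    diff-+ = Δ.diff-+

    diff-neg : ∀ a b → ℚ.- (a ℚ.- b) ≡ (ℚ.- a) ℚ.- (ℚ.- b)
    diff-neg = Δ.diff-neg

    diff-trans : ∀ a b c → (a ℚ.- b) ℚ.+ (b ℚ.- c) ≡ a ℚ.- c
    diff-trans = Δ.diff-trans

    diff-* : ∀ a b c d → a ℚ.* (c ℚ.- d) ℚ.+ d ℚ.* (a ℚ.- b) ≡ a ℚ.* c ℚ.- b ℚ.* d
    diff-* = Δ.diff-*

    diff-swap : ∀ a b → ℚ.- (a ℚ.- b) ≡ b ℚ.- a
    diff-swap = AbelianGroupProperties.⁻¹-anti-homo‿- ℚ.+-0-abelianGroup

    diff-split : ∀ b a → (a ℚ.- b) ℚ.+ b ≡ a
    diff-split = AbelianGroupProperties.//-rightDividesˡ ℚ.+-0-abelianGroup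

  -- Families (u i) of rationals tending to 0 along a filter on I generated by
  -- the tails  i from N ; used for I = ℕ and for I = ℕ × ℕ.
  module Vanish (I : Set) (_from_ : I → ℕ → Set)
    (antitone : ∀ {i M N} → M ℕ.≤ N → i from N → i from M) where

    Eventually : (I → Set) → Set
    Eventually P = ∃ λ N → ∀ i → i from N → P i

    Vanishing : (I → ℚ) → Set
    Vanishing u = ∀ ε → 0ℚ ℚ.< ε → Eventually λ i → ℚ.∣ u i ∣ ℚ.< ε

    both : ∀ {P Q : I → Set} → Eventually P → Eventually Q → Eventually λ i → P i × Q i
    both (M , p) (N , q) = M ℕ.⊔ N , λ i h →
      p i (antitone (ℕ.m≤m⊔n M N) h) , q i (antitone (ℕ.m≤n⊔m M N) h)

    vanish-resp : ∀ u v → (∀ i → u i ≡ v i) → Vanishing u → Vanishing v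
    vanish-resp u v e h ε ε>0 with h ε ε>0
    ... | N , p = N , λ i q → subst (λ z → ℚ.∣ z ∣ ℚ.< ε) (e i) (p i q)

    vanish-≤ : ∀ u v → Eventually (λ i → ℚ.∣ v i ∣ ℚ.≤ ℚ.∣ u i ∣) → Vanishing u → Vanishing v
    vanish-≤ u v le h ε ε>0 with both le (h ε ε>0)
    ... | N , p = N , λ i q → ℚ.≤-<-trans (proj₁ (p i q)) (proj₂ (p i q))

    vanish-0 : ∀ u → (∀ i → u i ≡ 0ℚ) → Vanishing u
    vanish-0 u e ε ε>0 = 0 , λ i _ → subst (λ z → ℚ.∣ z ∣ ℚ.< ε) (sym (e i)) ε>0

    vanish-+ : ∀ u v → Vanishing u → Vanishing v → Vanishing λ i → u i ℚ.+ v i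
    vanish-+ u v h k ε ε>0 = proj₁ ev , λ i q → bound i (proj₂ ev i q)
      where
      δ = ½ ℚ.* ε
      δ>0 : 0ℚ ℚ.< δ
      δ>0 = subst (ℚ._< δ) (ℚ.*-zeroʳ ½) (ℚ.*-monoʳ-<-pos ½ ε>0)
      δ+δ≡ε : δ ℚ.+ δ ≡ ε
      δ+δ≡ε = trans (sym (ℚ.*-distribʳ-+ ε ½ ½)) (ℚ.*-identityˡ ε)
      ev = both (h δ δ>0) (k δ δ>0)
      bound : ∀ i → ℚ.∣ u i ∣ ℚ.< δ × ℚ.∣ v i ∣ ℚ.< δ → ℚ.∣ u i ℚ.+ v i ∣ ℚ.< ε
      bound i (p , q) = ℚ.≤-<-trans (ℚ.∣p+q∣≤∣p∣+∣q∣ (u i) (v i))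
        (subst (ℚ.∣ u i ∣ ℚ.+ ℚ.∣ v i ∣ ℚ.<_) δ+δ≡ε (ℚ.+-mono-< p q))

    vanish-neg : ∀ u → Vanishing u → Vanishing λ i → ℚ.- u i
    vanish-neg u = vanish-≤ u (λ i → ℚ.- u i) (0 , λ i _ → ℚ.≤-reflexive (ℚ.∣-p∣≡∣p∣ (u i)))

    vanish-* : ∀ (u b : I → ℚ) B → Eventually (λ i → ℚ.∣ b i ∣ ℚ.≤ B) →
               Vanishing u → Vanishing λ i → b i ℚ.* u i
    vanish-* u b B bd h ε ε>0 = proj₁ ev , λ i q → bound i (proj₂ ev i q)
      where
      C = 1ℚ ℚ.⊔ B
      instance
        C>0 : ℚ.Positive C
        C>0 = ℚ.positive (ℚ.<-≤-trans (ℚ.positive⁻¹ 1ℚ) (ℚ.p≤p⊔q 1ℚ B))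
        C≢0 : ℚ.NonZero C
        C≢0 = ℚ.pos⇒nonZero C
        1/C>0 : ℚ.Positive (ℚ.1/ C)
        1/C>0 = ℚ.1/pos⇒pos C
      δ = (ℚ.1/ C) ℚ.* ε
      δ>0 : 0ℚ ℚ.< δ
      δ>0 = subst (ℚ._< δ) (ℚ.*-zeroʳ (ℚ.1/ C)) (ℚ.*-monoʳ-<-pos (ℚ.1/ C) ε>0)
      ev = both bd (h δ δ>0)
      Cδ≡ε : C ℚ.* δ ≡ ε
      Cδ≡ε = trans (sym (ℚ.*-assoc C (ℚ.1/ C) ε))
        (trans (cong (ℚ._* ε) (ℚ.*-inverseʳ C)) (ℚ.*-identityˡ ε))
      bound : ∀ i → ℚ.∣ b i ∣ ℚ.≤ B × ℚ.∣ u i ∣ ℚ.< δ → ℚ.∣ b i ℚ.* u i ∣ ℚ.< ε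
      bound i (p , q) = begin-strict
        ℚ.∣ b i ℚ.* u i ∣       ≡⟨ ℚ.∣p*q∣≡∣p∣*∣q∣ (b i) (u i) ⟩
        ℚ.∣ b i ∣ ℚ.* ℚ.∣ u i ∣ ≤⟨ ℚ.*-monoʳ-≤-nonNeg ℚ.∣ u i ∣ ⦃ ℚ.∣-∣-nonNeg (u i) ⦄ (ℚ.≤-trans p (ℚ.p≤q⊔p 1ℚ B)) ⟩
        C ℚ.* ℚ.∣ u i ∣         <⟨ ℚ.*-monoʳ-<-pos C q ⟩
        C ℚ.* δ                 ≡⟨ Cδ≡ε ⟩
        ε ∎
        where open ℚ.≤-Reasoning

Cauchy : (ℕ → ℚ) → Set
Cauchy x = ∀ ε → 0ℚ ℚ.< ε → ∃ λ N → ∀ m n → N ℕ.≤ m → N ℕ.≤ n → ℚ.∣ x m ℚ.- x n ∣ ℚ.< ε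

record ℝ : Set where
  constructor mkℝ
  field
    seq    : ℕ → ℚ
    cauchy : Cauchy seq

open ℝ

infix 4 _≈ᴿ_ _<ᴿ_ _≤ᴿ_

record _≈ᴿ_ (x y : ℝ) : Set where
  constructor mk≈
  field
    difference→0 : ∀ ε → 0ℚ ℚ.< ε → ∃ λ N → ∀ n → N ℕ.≤ n → ℚ.∣ seq x n ℚ.- seq y n ∣ ℚ.< ε

_<ᴿ_ : ℝ → ℝ → Set
x <ᴿ y = ∃ λ ε → 0ℚ ℚ.< ε × ∃ λ N → ∀ n → N ℕ.≤ n → seq x n ℚ.+ ε ℚ.< seq y n

_≤ᴿ_ : ℝ → ℝ → Set
x ≤ᴿ y = ¬ (y <ᴿ x)

private
  module V₁ = Vanish ℕ (λ n N → N ℕ.≤ n) ℕ.≤-trans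
  module V₂ = Vanish (ℕ × ℕ) (λ i N → N ℕ.≤ proj₁ i × N ℕ.≤ proj₂ i)
                (λ h p → ℕ.≤-trans h (proj₁ p) , ℕ.≤-trans h (proj₂ p))

  gap : (ℕ → ℚ) → ℕ × ℕ → ℚ
  gap x i = x (proj₁ i) ℚ.- x (proj₂ i)

  cauchy⇒gap→0 : ∀ x → Cauchy x → V₂.Vanishing (gap x)
  cauchy⇒gap→0 x h ε ε>0 with h ε ε>0
  ... | N , p = N , λ i q → p (proj₁ i) (proj₂ i) (proj₁ q) (proj₂ q)

  gap→0⇒cauchy : ∀ x → V₂.Vanishing (gap x) → Cauchy x
  gap→0⇒cauchy x h ε ε>0 with h ε ε>0
  ... | N , p = N , λ m n q r → p (m , n) (q , r)

  bounded : ∀ x → Cauchy x → ∃ λ B → ∃ λ N → ∀ n → N ℕ.≤ n → ℚ.∣ x n ∣ ℚ.≤ B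
  bounded x h with h 1ℚ (ℚ.positive⁻¹ 1ℚ)
  ... | N , p = 1ℚ ℚ.+ ℚ.∣ x N ∣ , N , λ n N≤n → begin
      ℚ.∣ x n ∣                          ≡⟨ cong ℚ.∣_∣ (ℚΔ.diff-split (x N) (x n)) ⟨
      ℚ.∣ (x n ℚ.- x N) ℚ.+ x N ∣        ≤⟨ ℚ.∣p+q∣≤∣p∣+∣q∣ (x n ℚ.- x N) (x N) ⟩
      ℚ.∣ x n ℚ.- x N ∣ ℚ.+ ℚ.∣ x N ∣    ≤⟨ ℚ.+-monoˡ-≤ ℚ.∣ x N ∣ (ℚ.<⇒≤ (p n N N≤n ℕ.≤-refl)) ⟩
      1ℚ ℚ.+ ℚ.∣ x N ∣                   ∎
    where open ℚ.≤-Reasoning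

  +-cauchy : ∀ x y → Cauchy x → Cauchy y → Cauchy λ n → x n ℚ.+ y n
  +-cauchy x y p q = gap→0⇒cauchy z (V₂.vanish-resp (λ i → gap x i ℚ.+ gap y i) (gap z)
    (λ (m , n) → ℚΔ.diff-+ (x m) (x n) (y m) (y n))
    (V₂.vanish-+ (gap x) (gap y) (cauchy⇒gap→0 x p) (cauchy⇒gap→0 y q)))
    where z = λ n → x n ℚ.+ y n

  neg-cauchy : ∀ x → Cauchy x → Cauchy λ n → ℚ.- x n
  neg-cauchy x p = gap→0⇒cauchy z (V₂.vanish-resp (λ i → ℚ.- gap x i) (gap z)
    (λ (m , n) → ℚΔ.diff-neg (x m) (x n))
    (V₂.vanish-neg (gap x) (cauchy⇒gap→0 x p)))
    where z = λ n → ℚ.- x n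

  *-cauchy : ∀ x y → Cauchy x → Cauchy y → Cauchy λ n → x n ℚ.* y n
  *-cauchy x y p q = gap→0⇒cauchy z (V₂.vanish-resp (λ i → u i ℚ.+ v i) (gap z)
    (λ (m , n) → ℚΔ.diff-* (x m) (x n) (y m) (y n))
    (V₂.vanish-+ u v
      (V₂.vanish-* (gap y) (λ i → x (proj₁ i)) B (proj₁ b , λ i h → proj₂ b (proj₁ i) (proj₁ h)) (cauchy⇒gap→0 y q))
      (V₂.vanish-* (gap x) (λ i → y (proj₂ i)) C (proj₁ c , λ i h → proj₂ c (proj₂ i) (proj₂ h)) (cauchy⇒gap→0 x p))))
    where
    B = proj₁ (bounded x p)
    b = proj₂ (bounded x p)
    C = proj₁ (bounded y q)
    c = proj₂ (bounded y q)
    z = λ n → x n ℚ.* y n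
    u v : ℕ × ℕ → ℚ
    u i = x (proj₁ i) ℚ.* gap y i
    v i = y (proj₂ i) ℚ.* gap x i

  const-cauchy : ∀ q → Cauchy λ _ → q
  const-cauchy q = gap→0⇒cauchy (λ _ → q) (V₂.vanish-0 (gap λ _ → q) λ _ → ℚ.+-inverseʳ q)

infixl 6 _+ᴿ_
infixl 7 _*ᴿ_
infix  8 -ᴿ_

-- Opaque so that type checking never unfolds arithmetic into Cauchy sequences.
opaque
  _+ᴿ_ _*ᴿ_ : ℝ → ℝ → ℝ
  x +ᴿ y = mkℝ (λ n → seq x n ℚ.+ seq y n) (+-cauchy (seq x) (seq y) (cauchy x) (cauchy y))
  x *ᴿ y = mkℝ (λ n → seq x n ℚ.* seq y n) (*-cauchy (seq x) (seq y) (cauchy x) (cauchy y))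

  -ᴿ_ : ℝ → ℝ
  -ᴿ x = mkℝ (λ n → ℚ.- seq x n) (neg-cauchy (seq x) (cauchy x))

  fromℚ : ℚ → ℝ
  fromℚ q = mkℝ (λ _ → q) (const-cauchy q)

0ᴿ 1ᴿ : ℝ
0ᴿ = fromℚ 0ℚ
1ᴿ = fromℚ 1ℚ

private
  _∸_ : ℝ → ℝ → ℕ → ℚ
  (x ∸ y) n = seq x n ℚ.- seq y n

  opaque
    unfolding _+ᴿ_

    pointwise : ∀ {x y} → (∀ n → seq x n ≡ seq y n) → x ≈ᴿ y
    pointwise {x} {y} e = mk≈ (V₁.vanish-0 (x ∸ y) λ n →
      trans (cong (ℚ._- seq y n) (e n)) (ℚ.+-inverseʳ (seq y n)))

    ≈ᴿ-isEquivalence : IsEquivalence _≈ᴿ_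
    ≈ᴿ-isEquivalence = record
      { refl  = pointwise λ _ → refl
      ; sym   = λ { {x} {y} (mk≈ p) → mk≈ (V₁.vanish-resp (λ n → ℚ.- (x ∸ y) n) (y ∸ x)
          (λ n → ℚΔ.diff-swap (seq x n) (seq y n)) (V₁.vanish-neg (x ∸ y) p)) }
      ; trans = λ { {x} {y} {z} (mk≈ p) (mk≈ q) → mk≈ (V₁.vanish-resp (λ n → (x ∸ y) n ℚ.+ (y ∸ z) n) (x ∸ z)
          (λ n → ℚΔ.diff-trans (seq x n) (seq y n) (seq z n)) (V₁.vanish-+ (x ∸ y) (y ∸ z) p q)) }
      }

    +ᴿ-cong : ∀ {x y u v} → x ≈ᴿ y → u ≈ᴿ v → x +ᴿ u ≈ᴿ y +ᴿ v
    +ᴿ-cong {x} {y} {u} {v} (mk≈ p) (mk≈ q) = mk≈ (V₁.vanish-resp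
      (λ n → (x ∸ y) n ℚ.+ (u ∸ v) n) ((x +ᴿ u) ∸ (y +ᴿ v))
      (λ n → ℚΔ.diff-+ (seq x n) (seq y n) (seq u n) (seq v n))
      (V₁.vanish-+ (x ∸ y) (u ∸ v) p q))

    -ᴿ-cong : ∀ {x y} → x ≈ᴿ y → -ᴿ x ≈ᴿ -ᴿ y
    -ᴿ-cong {x} {y} (mk≈ p) = mk≈ (V₁.vanish-resp (λ n → ℚ.- (x ∸ y) n) ((-ᴿ x) ∸ (-ᴿ y))
      (λ n → ℚΔ.diff-neg (seq x n) (seq y n)) (V₁.vanish-neg (x ∸ y) p))

    *ᴿ-cong : ∀ {x y u v} → x ≈ᴿ y → u ≈ᴿ v → x *ᴿ u ≈ᴿ y *ᴿ v
    *ᴿ-cong {x} {y} {u} {v} (mk≈ p) (mk≈ q) = mk≈ (V₁.vanish-resp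
      (λ n → s n ℚ.+ t n) ((x *ᴿ u) ∸ (y *ᴿ v))
      (λ n → ℚΔ.diff-* (seq x n) (seq y n) (seq u n) (seq v n))
      (V₁.vanish-+ s t
        (V₁.vanish-* (u ∸ v) (seq x) (proj₁ (bounded (seq x) (cauchy x))) (proj₂ (bounded (seq x) (cauchy x))) q)
        (V₁.vanish-* (x ∸ y) (seq v) (proj₁ (bounded (seq v) (cauchy v))) (proj₂ (bounded (seq v) (cauchy v))) p)))
      where
      s t : ℕ → ℚ
      s n = seq x n ℚ.* (u ∸ v) n
      t n = seq v n ℚ.* (x ∸ y) n

opaque
  unfolding _+ᴿ_

  ℝ-isCommutativeRing : IsCommutativeRing _≈ᴿ_ _+ᴿ_ _*ᴿ_ -ᴿ_ 0ᴿ 1ᴿ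
  ℝ-isCommutativeRing = record
    { isRing = record
      { +-isAbelianGroup = record
        { isGroup = record
          { isMonoid = record
            { isSemigroup = record
              { isMagma = record { isEquivalence = ≈ᴿ-isEquivalence ; ∙-cong = +ᴿ-cong }
              ; assoc   = λ x y z → pointwise λ n → ℚ.+-assoc (seq x n) (seq y n) (seq z n)
              }
            ; identity = (λ x → pointwise λ n → ℚ.+-identityˡ (seq x n))
                       , (λ x → pointwise λ n → ℚ.+-identityʳ (seq x n))
            }
          ; inverse = (λ x → pointwise λ n → ℚ.+-inverseˡ (seq x n))
                    , (λ x → pointwise λ n → ℚ.+-inverseʳ (seq x n))
          ; ⁻¹-cong = -ᴿ-cong
          }
        ; comm = λ x y → pointwise λ n → ℚ.+-comm (seq x n) (seq y n)
        }
      ; *-cong     = *ᴿ-cong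
      ; *-assoc    = λ x y z → pointwise λ n → ℚ.*-assoc (seq x n) (seq y n) (seq z n)
      ; *-identity = (λ x → pointwise λ n → ℚ.*-identityˡ (seq x n))
                   , (λ x → pointwise λ n → ℚ.*-identityʳ (seq x n))
      ; distrib    = (λ x y z → pointwise λ n → ℚ.*-distribˡ-+ (seq x n) (seq y n) (seq z n))
                   , (λ x y z → pointwise λ n → ℚ.*-distribʳ-+ (seq x n) (seq y n) (seq z n))
      }
    ; *-comm = λ x y → pointwise λ n → ℚ.*-comm (seq x n) (seq y n)
    }

ℝ-commutativeRing : CommutativeRing 0ℓ 0ℓ
ℝ-commutativeRing = record { isCommutativeRing = ℝ-isCommutativeRing }

module AdjoinI (R : CommutativeRing 0ℓ 0ℓ) where
  open CommutativeRing R renaming (refl to ≈-refl; sym to ≈-sym; trans to ≈-trans)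

  infix 5 _+i_
  infix 4 _≈ᶜ_
  infixl 6 _+ᶜ_
  infixl 7 _*ᶜ_
  infix  8 -ᶜ_

  record ℂ : Set where
    constructor _+i_
    field
      re im : Carrier

  open ℂ public

  record _≈ᶜ_ (z w : ℂ) : Set where
    constructor mk≈ᶜ
    field
      re≈ : re z ≈ re w
      im≈ : im z ≈ im w

  open _≈ᶜ_ public

  _+ᶜ_ _*ᶜ_ : ℂ → ℂ → ℂ
  (a +i b) +ᶜ (c +i d) = (a + c) +i (b + d)
  (a +i b) *ᶜ (c +i d) = (a * c - b * d) +i (a * d + b * c)

  -ᶜ_ : ℂ → ℂ
  -ᶜ (a +i b) = (- a) +i (- b)

  ofReal : Carrier → ℂ
  ofReal x = x +i 0#

  0ᶜ 1ᶜ : ℂ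
  0ᶜ = ofReal 0#
  1ᶜ = ofReal 1#

  private
    open Differences R
    open RingProperties ring using (x[y-z]≈xy-xz; [y-z]x≈yx-zx; -0#≈0#)
    open CommutativeSemigroupProperties +-commutativeSemigroup using (interchange)

    isEquivalence-ᶜ : IsEquivalence _≈ᶜ_
    isEquivalence-ᶜ = record
      { refl  = mk≈ᶜ ≈-refl ≈-refl
      ; sym   = λ (mk≈ᶜ p q) → mk≈ᶜ (≈-sym p) (≈-sym q)
      ; trans = λ (mk≈ᶜ p q) (mk≈ᶜ r s) → mk≈ᶜ (≈-trans p r) (≈-trans q s)
      }

    setoid-ᶜ : Setoid 0ℓ 0ℓ
    setoid-ᶜ = record { isEquivalence = isEquivalence-ᶜ }

    *ᶜ-cong : ∀ {x y u v} → x ≈ᶜ y → u ≈ᶜ v → x *ᶜ u ≈ᶜ y *ᶜ v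
    *ᶜ-cong (mk≈ᶜ p q) (mk≈ᶜ r s) = mk≈ᶜ
      (+-cong (*-cong p r) (-‿cong (*-cong q s))) (+-cong (*-cong p s) (*-cong q r))

    *ᶜ-assoc : ∀ x y z → (x *ᶜ y) *ᶜ z ≈ᶜ x *ᶜ (y *ᶜ z)
    *ᶜ-assoc (a +i b) (c +i d) (e +i f) = mk≈ᶜ
      (begin
        (a * c - b * d) * e - (a * d + b * c) * f                   ≈⟨ +-cong ([y-z]x≈yx-zx e _ _) (-‿cong (distribʳ f _ _)) ⟩
        (a * c * e - b * d * e) - (a * d * f + b * c * f)           ≈⟨ diff-shuffle _ _ _ _ ⟩
        (a * c * e - a * d * f) - (b * c * f + b * d * e)           ≈⟨ +-cong (+-cong (*-assoc a c e) (-‿cong (*-assoc a d f)))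
                                                                         (-‿cong (+-cong (*-assoc b c f) (*-assoc b d e))) ⟩
        (a * (c * e) - a * (d * f)) - (b * (c * f) + b * (d * e))   ≈⟨ +-cong (x[y-z]≈xy-xz a _ _) (-‿cong (distribˡ b _ _)) ⟨
        a * (c * e - d * f) - b * (c * f + d * e)                   ∎)
      (begin
        (a * c - b * d) * f + (a * d + b * c) * e                   ≈⟨ +-cong ([y-z]x≈yx-zx f _ _) (distribʳ e _ _) ⟩
        (a * c * f - b * d * f) + (a * d * e + b * c * e)           ≈⟨ sum-shuffle _ _ _ _ ⟩
        (a * c * f + a * d * e) + (b * c * e - b * d * f)           ≈⟨ +-cong (+-cong (*-assoc a c f) (*-assoc a d e))
                                                                         (+-cong (*-assoc b c e) (-‿cong (*-assoc b d f))) ⟩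
        (a * (c * f) + a * (d * e)) + (b * (c * e) - b * (d * f))   ≈⟨ +-cong (distribˡ a _ _) (x[y-z]≈xy-xz b _ _) ⟨
        a * (c * f + d * e) + b * (c * e - d * f)                   ∎)
      where open SetoidReasoning setoid

    *ᶜ-comm : ∀ x y → x *ᶜ y ≈ᶜ y *ᶜ x
    *ᶜ-comm (a +i b) (c +i d) = mk≈ᶜ
      (+-cong (*-comm a c) (-‿cong (*-comm b d)))
      (≈-trans (+-comm _ _) (+-cong (*-comm b c) (*-comm a d)))

    *ᶜ-identityˡ : ∀ x → 1ᶜ *ᶜ x ≈ᶜ x
    *ᶜ-identityˡ (a +i b) = mk≈ᶜ
      (≈-trans (+-cong (*-identityˡ a) (≈-trans (-‿cong (zeroˡ b)) -0#≈0#)) (+-identityʳ a))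
      (≈-trans (+-cong (*-identityˡ b) (zeroˡ a)) (+-identityʳ b))

    distribˡ-ᶜ : ∀ x y z → x *ᶜ (y +ᶜ z) ≈ᶜ x *ᶜ y +ᶜ x *ᶜ z
    distribˡ-ᶜ (a +i b) (c +i d) (e +i f) = mk≈ᶜ
      (≈-trans (+-cong (distribˡ a c e) (-‿cong (distribˡ b d f))) (≈-sym (diff-+ _ _ _ _)))
      (≈-trans (+-cong (distribˡ a d f) (distribˡ b c e)) (interchange _ _ _ _))

    +ᶜ-cong : ∀ {x y u v} → x ≈ᶜ y → u ≈ᶜ v → x +ᶜ u ≈ᶜ y +ᶜ v
    +ᶜ-cong (mk≈ᶜ p q) (mk≈ᶜ r s) = mk≈ᶜ (+-cong p r) (+-cong q s)

    open Consequences setoid-ᶜ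

    isCommutativeRing-ᶜ : IsCommutativeRing _≈ᶜ_ _+ᶜ_ _*ᶜ_ -ᶜ_ 0ᶜ 1ᶜ
    isCommutativeRing-ᶜ = record
      { isRing = record
        { +-isAbelianGroup = record
          { isGroup = record
            { isMonoid = record
              { isSemigroup = record
                { isMagma = record { isEquivalence = isEquivalence-ᶜ ; ∙-cong = +ᶜ-cong }
                ; assoc   = λ (a +i b) (c +i d) (e +i f) → mk≈ᶜ (+-assoc a c e) (+-assoc b d f)
                }
              ; identity = (λ (a +i b) → mk≈ᶜ (+-identityˡ a) (+-identityˡ b))
                         , (λ (a +i b) → mk≈ᶜ (+-identityʳ a) (+-identityʳ b))
              }
            ; inverse = (λ (a +i b) → mk≈ᶜ (-‿inverseˡ a) (-‿inverseˡ b))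
                      , (λ (a +i b) → mk≈ᶜ (-‿inverseʳ a) (-‿inverseʳ b))
            ; ⁻¹-cong = λ (mk≈ᶜ p q) → mk≈ᶜ (-‿cong p) (-‿cong q)
            }
          ; comm = λ (a +i b) (c +i d) → mk≈ᶜ (+-comm a c) (+-comm b d)
          }
        ; *-cong     = *ᶜ-cong
        ; *-assoc    = *ᶜ-assoc
        ; *-identity = comm∧idˡ⇒id *ᶜ-comm *ᶜ-identityˡ
        ; distrib    = comm∧distrˡ⇒distr +ᶜ-cong *ᶜ-comm distribˡ-ᶜ
        }
      ; *-comm = *ᶜ-comm
      }

  ℂ-commutativeRing : CommutativeRing 0ℓ 0ℓ
  ℂ-commutativeRing = record { isCommutativeRing = isCommutativeRing-ᶜ }

  ofReal-* : ∀ a b → ofReal a *ᶜ ofReal b ≈ᶜ ofReal (a * b)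
  ofReal-* a b = mk≈ᶜ
    (≈-trans (+-congˡ (≈-trans (-‿cong (zeroˡ 0#)) -0#≈0#)) (+-identityʳ _))
    (≈-trans (+-cong (zeroʳ a) (zeroˡ b)) (+-identityʳ 0#))

  imaginary-* : ∀ a b → (0# +i a) *ᶜ (0# +i b) ≈ᶜ ofReal (- (a * b))
  imaginary-* a b = mk≈ᶜ
    (≈-trans (+-congʳ (zeroˡ 0#)) (+-identityˡ _))
    (≈-trans (+-cong (zeroˡ b) (zeroʳ a)) (+-identityʳ 0#))

open AdjoinI ℝ-commutativeRing public

infixl 6 _-ᶜ_

_-ᶜ_ : ℂ → ℂ → ℂ
z -ᶜ w = z +ᶜ (-ᶜ w)

ofℤ : ℤ → ℂ
ofℤ n = ofReal (fromℚ (fromℤ n))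

-- Principal branch: arg z ∈ (-π/2, π/2], together with z = 0.
IsPrincipal : ℂ → Set
IsPrincipal z = 0ᴿ <ᴿ re z ⊎ (re z ≈ᴿ 0ᴿ × 0ᴿ ≤ᴿ im z)

IsPrincipalSqrt : ℂ → ℂ → Set
IsPrincipalSqrt w z = w *ᶜ w ≈ᶜ z × IsPrincipal w

⌊√_⌋ : ℕ → ℕ
⌊√ zero ⌋  = zero
⌊√ suc n ⌋ with suc ⌊√ n ⌋ ℕ.* suc ⌊√ n ⌋ ℕ.≤? suc n
... | yes _ = suc ⌊√ n ⌋
... | no  _ = ⌊√ n ⌋

⌊√⌋-spec : ∀ n → ⌊√ n ⌋ ℕ.* ⌊√ n ⌋ ℕ.≤ n × n ℕ.< suc ⌊√ n ⌋ ℕ.* suc ⌊√ n ⌋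
⌊√⌋-spec zero = z≤n , s≤s z≤n
⌊√⌋-spec (suc n) with suc ⌊√ n ⌋ ℕ.* suc ⌊√ n ⌋ ℕ.≤? suc n
... | yes p = p , ℕ.≤-<-trans (proj₂ (⌊√⌋-spec n))
                    (ℕ.*-mono-< (ℕ.n<1+n (suc ⌊√ n ⌋)) (ℕ.n<1+n (suc ⌊√ n ⌋)))
... | no ¬p = ℕ.m≤n⇒m≤1+n (proj₁ (⌊√⌋-spec n)) , ℕ.≰⇒> ¬p

private
  _/suc_ : ℕ → ℕ → ℚ
  a /suc k = + a ℚ./ suc k

  /suc≃ : ∀ a k → ℚ.toℚᵘ (a /suc k) ℚᵘ.≃ mkℚᵘ (+ a) k
  /suc≃ a k = ℚ.toℚᵘ-fromℚᵘ (mkℚᵘ (+ a) k)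

  /suc-< : ∀ a b k j → a ℕ.* suc j ℕ.< b ℕ.* suc k → (a /suc k) ℚ.< (b /suc j)
  /suc-< a b k j h = ℚ.toℚᵘ-cancel-<
    (ℚᵘ.<-respˡ-≃ (ℚᵘ.≃-sym (/suc≃ a k)) (ℚᵘ.<-respʳ-≃ (ℚᵘ.≃-sym (/suc≃ b j))
      (*<* (subst₂ ℤ._<_ (ℤ.pos-* a (suc j)) (ℤ.pos-* b (suc k)) (ℤ.+<+ h)))))

  /suc-≤ : ∀ a b k j → a ℕ.* suc j ℕ.≤ b ℕ.* suc k → (a /suc k) ℚ.≤ (b /suc j)
  /suc-≤ a b k j h = ℚ.toℚᵘ-cancel-≤
    (ℚᵘ.≤-respˡ-≃ (ℚᵘ.≃-sym (/suc≃ a k)) (ℚᵘ.≤-respʳ-≃ (ℚᵘ.≃-sym (/suc≃ b j))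
      (*≤* (subst₂ ℤ._≤_ (ℤ.pos-* a (suc j)) (ℤ.pos-* b (suc k)) (ℤ.+≤+ h)))))

  /suc-+1 : ∀ a k → (a /suc k) ℚ.+ (1 /suc k) ≡ suc a /suc k
  /suc-+1 a k = ℚ.toℚᵘ-injective (begin
    ℚ.toℚᵘ ((a /suc k) ℚ.+ (1 /suc k))            ≈⟨ ℚ.toℚᵘ-homo-+ (a /suc k) (1 /suc k) ⟩
    ℚ.toℚᵘ (a /suc k) ℚᵘ.+ ℚ.toℚᵘ (1 /suc k)      ≈⟨ ℚᵘ.+-cong (/suc≃ a k) (/suc≃ 1 k) ⟩
    mkℚᵘ (+ a) k ℚᵘ.+ mkℚᵘ (+ 1) k                ≈⟨ *≡* numerators ⟩
    mkℚᵘ (+ suc a) k                              ≈⟨ /suc≃ (suc a) k ⟨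
    ℚ.toℚᵘ (suc a /suc k)                         ∎)
    where
    open SetoidReasoning ℚᵘ.≃-setoid
    K = + suc k
    numerators : (+ a ℤ.* K ℤ.+ + 1 ℤ.* K) ℤ.* K ≡ + suc a ℤ.* (K ℤ.* K)
    numerators = trans (cong (ℤ._* K) (trans (sym (ℤ.*-distribʳ-+ K (+ a) (+ 1)))
      (cong (λ t → + t ℤ.* K) (ℕ.+-comm a 1)))) (ℤ.*-assoc (+ suc a) K K)

  /suc-square : ∀ a k → ℚ.toℚᵘ ((a /suc k) ℚ.* (a /suc k)) ℚᵘ.≃ mkℚᵘ (+ a) k ℚᵘ.* mkℚᵘ (+ a) k
  /suc-square a k = ℚᵘ.≃-trans (ℚ.toℚᵘ-homo-* (a /suc k) (a /suc k)) (ℚᵘ.*-cong (/suc≃ a k) (/suc≃ a k))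

  square-≤ : ∀ a n k → a ℕ.* a ℕ.≤ n ℕ.* (suc k ℕ.* suc k) →
             (a /suc k) ℚ.* (a /suc k) ℚ.≤ fromℤ (+ n)
  square-≤ a n k h = ℚ.toℚᵘ-cancel-≤ (ℚᵘ.≤-respˡ-≃ (ℚᵘ.≃-sym (/suc-square a k))
    (*≤* (subst₂ ℤ._≤_ (trans (ℤ.pos-* a a) (sym (ℤ.*-identityʳ _))) (ℤ.pos-* n _) (ℤ.+≤+ h))))

  square-> : ∀ a n k → n ℕ.* (suc k ℕ.* suc k) ℕ.< a ℕ.* a →
             fromℤ (+ n) ℚ.< (a /suc k) ℚ.* (a /suc k)
  square-> a n k h = ℚ.toℚᵘ-cancel-< (ℚᵘ.<-respʳ-≃ (ℚᵘ.≃-sym (/suc-square a k))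
    (*<* (subst₂ ℤ._<_ (ℤ.pos-* n _) (trans (ℤ.pos-* a a) (sym (ℤ.*-identityʳ _))) (ℤ.+<+ h))))

  archimedean : ∀ ε → 0ℚ ℚ.< ε → ∃ λ N → ∀ n → N ℕ.≤ n → (1 /suc n) ℚ.< ε
  archimedean (mkℚ (+ zero)  q c) (*<* (ℤ.+<+ ()))
  archimedean (mkℚ (+ suc p) q c) _ = suc q , λ n q<n → ℚ.toℚᵘ-cancel-<
    (ℚᵘ.<-respˡ-≃ (ℚᵘ.≃-sym (/suc≃ 1 n)) (*<* (ℤ.+<+ (begin-strict
      1 ℕ.* suc q       ≡⟨ ℕ.*-identityˡ (suc q) ⟩
      suc q             <⟨ s≤s q<n ⟩
      suc n             ≤⟨ ℕ.m≤m+n (suc n) (p ℕ.* suc n) ⟩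
      suc p ℕ.* suc n   ∎))))
    where open ℕ.≤-Reasoning

  sub-< : ∀ p q ε → p ℚ.< q ℚ.+ ε → p ℚ.- q ℚ.< ε
  sub-< p q ε h = subst (p ℚ.- q ℚ.<_) (trans (cong (ℚ._- q) (ℚ.+-comm q ε))
    (AbelianGroupProperties.//-rightDividesʳ ℚ.+-0-abelianGroup q ε)) (ℚ.+-monoˡ-< (ℚ.- q) h)

  close : ∀ p q ε → p ℚ.< q ℚ.+ ε → q ℚ.< p ℚ.+ ε → ℚ.∣ p ℚ.- q ∣ ℚ.< ε
  close p q ε h k = case (ℚ.∣p∣≡p∨∣p∣≡-p (p ℚ.- q))
    where
    case : ℚ.∣ p ℚ.- q ∣ ≡ p ℚ.- q ⊎ ℚ.∣ p ℚ.- q ∣ ≡ ℚ.- (p ℚ.- q) → ℚ.∣ p ℚ.- q ∣ ℚ.< ε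
    case (inj₁ e) = subst (ℚ._< ε) (sym e) (sub-< p q ε h)
    case (inj₂ e) = subst (ℚ._< ε) (sym (trans e (ℚΔ.diff-swap p q))) (sub-< q p ε k)

  p≤∣p∣ : ∀ p → p ℚ.≤ ℚ.∣ p ∣
  p≤∣p∣ (mkℚ (+ _) _ _)    = ℚ.≤-refl
  p≤∣p∣ p@(mkℚ -[1+ _ ] _ _) = ℚ.≤-trans (ℚ.<⇒≤ (ℚ.negative⁻¹ p)) (ℚ.0≤∣p∣ p)

  <-+ε : ∀ p ε → 0ℚ ℚ.< ε → p ℚ.< p ℚ.+ ε
  <-+ε p ε h = subst (ℚ._< p ℚ.+ ε) (ℚ.+-identityʳ p) (ℚ.+-monoʳ-< p h)

-- The k-th approximation of √ n is ⌊(k+1)√n⌋ / (k+1).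
module NaturalSqrt (n : ℕ) where

  numerator : ℕ → ℕ
  numerator k = ⌊√ n ℕ.* (suc k ℕ.* suc k) ⌋

  approximation : ℕ → ℚ
  approximation k = + numerator k ℚ./ suc k

  private
    spec : ∀ k → numerator k ℕ.* numerator k ℕ.≤ n ℕ.* (suc k ℕ.* suc k)
               × n ℕ.* (suc k ℕ.* suc k) ℕ.< suc (numerator k) ℕ.* suc (numerator k)
    spec k = ⌊√⌋-spec (n ℕ.* (suc k ℕ.* suc k))

    cross : ∀ k j → numerator k ℕ.* suc j ℕ.< suc (numerator j) ℕ.* suc k
    cross k j = ℕ.≰⇒> λ h → ℕ.<-irrefl refl (begin-strict
      (b ℕ.* b) ℕ.* (K ℕ.* K)       ≡⟨ ℕ.[m*n]*[o*p]≡[m*o]*[n*p] b b K K ⟩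
      (b ℕ.* K) ℕ.* (b ℕ.* K)       ≤⟨ ℕ.*-mono-≤ h h ⟩
      (a ℕ.* J) ℕ.* (a ℕ.* J)       ≡⟨ ℕ.[m*n]*[o*p]≡[m*o]*[n*p] a J a J ⟩
      (a ℕ.* a) ℕ.* (J ℕ.* J)       ≤⟨ ℕ.*-monoˡ-≤ (J ℕ.* J) (proj₁ (spec k)) ⟩
      n ℕ.* (K ℕ.* K) ℕ.* (J ℕ.* J) ≡⟨ ℕ.*-assoc n (K ℕ.* K) (J ℕ.* J) ⟩
      n ℕ.* (K ℕ.* K ℕ.* (J ℕ.* J)) ≡⟨ cong (n ℕ.*_) (ℕ.*-comm (K ℕ.* K) (J ℕ.* J)) ⟩
      n ℕ.* (J ℕ.* J ℕ.* (K ℕ.* K)) ≡⟨ ℕ.*-assoc n (J ℕ.* J) (K ℕ.* K) ⟨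
      n ℕ.* (J ℕ.* J) ℕ.* (K ℕ.* K) <⟨ ℕ.*-monoˡ-< (K ℕ.* K) (proj₂ (spec j)) ⟩
      (b ℕ.* b) ℕ.* (K ℕ.* K)       ∎)
      where
      open ℕ.≤-Reasoning
      a = numerator k
      b = suc (numerator j)
      K = suc k
      J = suc j

    near : ∀ k j → approximation k ℚ.< approximation j ℚ.+ (1 /suc j)
    near k j = subst (approximation k ℚ.<_) (sym (/suc-+1 (numerator j) j))
      (/suc-< (numerator k) (suc (numerator j)) k j (cross k j))

    approximation-cauchy : Cauchy approximation
    approximation-cauchy ε ε>0 = proj₁ arch , λ k j N≤k N≤j →
      close (approximation k) (approximation j) ε
        (ℚ.<-trans (near k j) (ℚ.+-monoʳ-< (approximation j) (proj₂ arch j N≤j)))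
        (ℚ.<-trans (near j k) (ℚ.+-monoʳ-< (approximation k) (proj₂ arch k N≤k)))
      where arch = archimedean ε ε>0

  sqrt : ℝ
  sqrt = mkℝ approximation approximation-cauchy

  private
    x δ : ℕ → ℚ
    x = approximation
    δ k = 1 /suc k

    δ→0 : V₁.Vanishing δ
    δ→0 ε ε>0 = proj₁ arch , λ k N≤k → subst (ℚ._< ε)
      (sym (ℚ.0≤p⇒∣p∣≡p (/suc-≤ 0 1 0 k z≤n))) (proj₂ arch k N≤k)
      where arch = archimedean ε ε>0

    excess : ℕ → ℚ
    excess k = x k ℚ.* δ k ℚ.+ (x k ℚ.* δ k ℚ.+ δ k ℚ.* δ k)

    square-excess : ∀ k → (x k ℚ.+ δ k) ℚ.* (x k ℚ.+ δ k) ≡ x k ℚ.* x k ℚ.+ excess k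
    square-excess k = expand (x k) (δ k)
      where
      expand : ∀ a d → (a ℚ.+ d) ℚ.* (a ℚ.+ d) ≡ a ℚ.* a ℚ.+ (a ℚ.* d ℚ.+ (a ℚ.* d ℚ.+ d ℚ.* d))
      expand a d = trans (ℚ.*-distribˡ-+ (a ℚ.+ d) a d)
        (trans (cong₂ ℚ._+_ (ℚ.*-distribʳ-+ a a d) (ℚ.*-distribʳ-+ d a d))
        (trans (ℚ.+-assoc (a ℚ.* a) (d ℚ.* a) _)
          (cong (λ t → a ℚ.* a ℚ.+ (t ℚ.+ (a ℚ.* d ℚ.+ d ℚ.* d))) (ℚ.*-comm d a))))

    excess→0 : V₁.Vanishing excess
    excess→0 = V₁.vanish-+ xδ (λ k → xδ k ℚ.+ δ k ℚ.* δ k) xδ→0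
      (V₁.vanish-+ xδ (λ k → δ k ℚ.* δ k) xδ→0 (V₁.vanish-* δ δ 1ℚ δ≤1 δ→0))
      where
      xδ : ℕ → ℚ
      xδ k = x k ℚ.* δ k
      B = bounded x approximation-cauchy
      xδ→0 = V₁.vanish-* δ x (proj₁ B) (proj₂ B) δ→0
      δ-ev = δ→0 1ℚ (ℚ.positive⁻¹ 1ℚ)
      δ≤1 : V₁.Eventually λ k → ℚ.∣ δ k ∣ ℚ.≤ 1ℚ
      δ≤1 = proj₁ δ-ev , λ k h → ℚ.<⇒≤ (proj₂ δ-ev k h)

  opaque
    unfolding _+ᴿ_

    sqrt-square : sqrt *ᴿ sqrt ≈ᴿ fromℚ (fromℤ (+ n))
    sqrt-square = mk≈ λ ε ε>0 → proj₁ (excess→0 ε ε>0) , λ k N≤k →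
      close (x k ℚ.* x k) (fromℤ (+ n)) ε
        (ℚ.≤-<-trans (square-≤ (numerator k) n k (proj₁ (spec k))) (<-+ε (fromℤ (+ n)) ε ε>0))
        (ℚ.<-trans (subst (fromℤ (+ n) ℚ.<_) (trans (cong (λ t → t ℚ.* t) (sym (/suc-+1 (numerator k) k))) (square-excess k))
            (square-> (suc (numerator k)) n k (proj₂ (spec k))))
          (ℚ.+-monoʳ-< (x k ℚ.* x k) (ℚ.≤-<-trans (p≤∣p∣ (excess k)) (proj₂ (excess→0 ε ε>0) k N≤k))))

    sqrt≥0 : 0ᴿ ≤ᴿ sqrt
    sqrt≥0 (ε , ε>0 , N , h) = ℚ.<-irrefl refl (ℚ.<-trans (h N ℕ.≤-refl)
      (ℚ.<-≤-trans ε>0 (subst (ε ℚ.≤_) (ℚ.+-comm ε (x N))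
        (subst (ℚ._≤ ε ℚ.+ x N) (ℚ.+-identityʳ ε) (ℚ.+-monoʳ-≤ ε (/suc-≤ 0 (numerator N) 0 N z≤n))))))

private
  opaque
    unfolding _+ᴿ_

    sqrt>0 : ∀ n → 0ᴿ <ᴿ NaturalSqrt.sqrt (suc n)
    sqrt>0 n = ½ , ℚ.positive⁻¹ ½ , 0 , λ k _ → ℚ.<-≤-trans ½<1 (/suc-≤ 1 (numerator k) 0 k (1≤ k))
      where
      open NaturalSqrt (suc n)
      open ℕ.≤-Reasoning
      ½<1 : 0ℚ ℚ.+ ½ ℚ.< 1 /suc 0
      ½<1 = *<* (ℤ.+<+ (s≤s (s≤s z≤n)))
      1≤ : ∀ k → 1 ℕ.* suc k ℕ.≤ numerator k ℕ.* 1
      1≤ k = subst₂ ℕ._≤_ (sym (ℕ.*-identityˡ (suc k))) (sym (ℕ.*-identityʳ (numerator k)))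
        (ℕ.≮⇒≥ λ a<K → ℕ.<-irrefl refl (begin-strict
          suc k ℕ.* suc k                          ≤⟨ ℕ.m≤m+n (suc k ℕ.* suc k) _ ⟩
          suc n ℕ.* (suc k ℕ.* suc k)              <⟨ proj₂ (⌊√⌋-spec (suc n ℕ.* (suc k ℕ.* suc k))) ⟩
          suc (numerator k) ℕ.* suc (numerator k)  ≤⟨ ℕ.*-mono-≤ a<K a<K ⟩
          suc k ℕ.* suc k                          ∎))

infix 9 √_

√_ : ℤ → ℂ
√ (+ n)    = NaturalSqrt.sqrt n +i 0ᴿ
√ -[1+ n ] = 0ᴿ +i NaturalSqrt.sqrt (suc n)

private
  module SqrtLaws where
    open CommutativeRing ℂ-commutativeRing using () renaming (trans to ≈ᶜ-trans)
    open CommutativeRing ℝ-commutativeRing using () renaming (refl to ≈ᴿ-refl)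

    ofReal-cong : ∀ {x y} → x ≈ᴿ y → ofReal x ≈ᶜ ofReal y
    ofReal-cong p = mk≈ᶜ p ≈ᴿ-refl

    opaque
      unfolding _+ᴿ_

      minus : ∀ n → -ᴿ fromℚ (fromℤ (+ suc n)) ≈ᴿ fromℚ (fromℤ -[1+ n ])
      minus n = pointwise λ _ → refl

    opaque
      unfolding _+ᴿ_

      sqrt0≈0 : NaturalSqrt.sqrt 0 ≈ᴿ 0ᴿ
      sqrt0≈0 = pointwise λ k → ℚ.0/n≡0 (suc k)

      0≤0 : 0ᴿ ≤ᴿ 0ᴿ
      0≤0 (ε , ε>0 , N , h) = ℚ.<-asym ε>0 (subst (ℚ._< 0ℚ) (ℚ.+-identityˡ ε) (h N ℕ.≤-refl))

    √-square : ∀ z → √ z *ᶜ √ z ≈ᶜ ofℤ z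
    √-square (+ n) = ≈ᶜ-trans (ofReal-* (NaturalSqrt.sqrt n) (NaturalSqrt.sqrt n))
      (ofReal-cong (NaturalSqrt.sqrt-square n))
    √-square -[1+ n ] = ≈ᶜ-trans (imaginary-* (NaturalSqrt.sqrt (suc n)) (NaturalSqrt.sqrt (suc n)))
      (ofReal-cong (IsEquivalence.trans ≈ᴿ-isEquivalence (-ᴿ-cong (NaturalSqrt.sqrt-square (suc n))) (minus n)))

    √-principal : ∀ z → IsPrincipal (√ z)
    √-principal (+ zero)  = inj₂ (sqrt0≈0 , 0≤0)
    √-principal (+ suc n) = inj₁ (sqrt>0 n)
    √-principal -[1+ n ]  = inj₂ (≈ᴿ-refl , NaturalSqrt.sqrt≥0 (suc n))

√-isPrincipalSqrt : ∀ z → IsPrincipalSqrt (√ z) (ofℤ z)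
√-isPrincipalSqrt z = SqrtLaws.√-square z , SqrtLaws.√-principal z

module Division (K : CommutativeRing 0ℓ 0ℓ) where
  open CommutativeRing K renaming (sym to ≈-sym; trans to ≈-trans)
  open AlgebraDefinitions _≈_ using (Invertible)
  open RawSemiringDefinitions (Semiring.rawSemiring semiring) public using (_^_)
  open CommutativeSemigroupProperties *-commutativeSemigroup using (interchange)

  Unit : Carrier → Set
  Unit = Invertible 1# _*_

  -- The bracketed argument carries the inverse of b; inverses are unique up to ≈,
  -- so the quotient does not depend on which witness is supplied.
  infixl 7 _/_[_]

  _/_[_] : ∀ a b → Unit b → Carrier
  a / _ [ b⁻¹ , _ ] = a * b⁻¹

  unit : ∀ {a} b → a * b ≈ 1# → Unit a
  unit {a} b p = b , ≈-trans (*-comm b a) p , p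

  unit-1 : Unit 1#
  unit-1 = unit 1# (*-identityˡ 1#)

  unit-* : ∀ {a b} → Unit a → Unit b → Unit (a * b)
  unit-* (a⁻¹ , _ , p) (b⁻¹ , _ , q) = unit (a⁻¹ * b⁻¹)
    (≈-trans (interchange _ _ a⁻¹ b⁻¹) (≈-trans (*-cong p q) (*-identityˡ 1#)))

  unit-^ : ∀ {a} → Unit a → ∀ n → Unit (a ^ n)
  unit-^ p zero    = unit-1
  unit-^ p (suc n) = unit-* p (unit-^ p n)

module PowerSeries (K : CommutativeRing 0ℓ 0ℓ) where
  open CommutativeRing K renaming (sym to ≈-sym; trans to ≈-trans)
  open Division K
  open RawMonoidDefinitions +-rawMonoid using (sum)
  open AbelianGroupProperties +-abelianGroup using (xyx⁻¹≈y)

  Series : Set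
  Series = ℕ → Carrier

  infix 4 _≈ₛ_
  infixr 7 _·_
  infixl 7 _⊛_ _÷_[_]

  _≈ₛ_ : Series → Series → Set
  F ≈ₛ G = ∀ n → F n ≈ G n

  polynomial : List Carrier → Series
  polynomial []       _       = 0#
  polynomial (a ∷ _)  zero    = a
  polynomial (_ ∷ as) (suc n) = polynomial as n

  _·_ : Carrier → Series → Series
  (c · F) n = c * F n

  -- The substitution F(cx).
  _⟨_·x⟩ : Series → Carrier → Series
  (F ⟨ c ·x⟩) n = c ^ n * F n

  _⊛_ : Series → Series → Series
  (F ⊛ G) n = sum {suc n} λ i → F (Fin.toℕ i) * G (n ℕ.∸ Fin.toℕ i)

  -- Long division: if c is the constant coefficient of F / G then
  -- F / G = c + x (((F - c G) / x) / G).
  _÷_[_] : Series → (G : Series) → Unit (G 0) → Series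
  (F ÷ G [ u ]) zero    = F 0 / G 0 [ u ]
  (F ÷ G [ u ]) (suc n) = ((λ k → F (suc k) - F 0 / G 0 [ u ] * G (suc k)) ÷ G [ u ]) n

  ÷-⊛ : ∀ F G u → (F ÷ G [ u ]) ⊛ G ≈ₛ F
  ÷-⊛ F G u@(_ , p , _) zero = ≈-trans (+-identityʳ _)
    (≈-trans (*-assoc _ _ _) (≈-trans (*-congˡ p) (*-identityʳ (F 0))))
  ÷-⊛ F G u (suc n) = ≈-trans (+-congˡ (÷-⊛ F′ G u n))
    (≈-trans (≈-sym (+-assoc c (F (suc n)) (- c))) (xyx⁻¹≈y c (F (suc n))))
    where
    F′ : Series
    F′ k = F (suc k) - F 0 / G 0 [ u ] * G (suc k)
    c = F 0 / G 0 [ u ] * G (suc n)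

module Chebyshev (K : CommutativeRing 0ℓ 0ℓ) where
  open CommutativeRing K

  S⁺ : ℕ → Carrier → Carrier
  S⁺ zero          x = 1#
  S⁺ (suc zero)    x = x
  S⁺ (suc (suc n)) x = x * S⁺ (suc n) x - S⁺ n x

  S : ℤ → Carrier → Carrier
  S (+ n)          x = S⁺ n x
  S -[1+ zero ]    x = 0#
  S -[1+ suc n ]   x = - S⁺ n x   -- -[1+ suc n ] is -n-2

  R : ℕ → Carrier → Carrier
  R n x = S (+ n) x - S (+ n ℤ.- + 2) x

open Division ℂ-commutativeRing public
open PowerSeries ℂ-commutativeRing public
open Chebyshev ℂ-commutativeRing public

private
  module UnitLaws where
    open CommutativeRing ℂ-commutativeRing
      using () renaming (trans to ≈ᶜ-trans; sym to ≈ᶜ-sym; *-assoc to *ᶜ-assoc; *-congʳ to *ᶜ-congʳ)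

    opaque
      unfolding _+ᴿ_

      fromℚ-* : ∀ p q → p ℚ.* q ≡ 1ℚ → fromℚ p *ᴿ fromℚ q ≈ᴿ 1ᴿ
      fromℚ-* p q e = pointwise λ _ → e

    fromℤ-nonZero : ∀ z → z ≢ 0ℤ → ℚ.NonZero (fromℤ z)
    fromℤ-nonZero z z≢0 = ℚ.≢-nonZero {fromℤ z} λ e → z≢0 (cong ℚ.numerator e)

    ofℤ-unit : ∀ z → z ≢ 0ℤ → Unit (ofℤ z)
    ofℤ-unit z z≢0 = unit (ofReal (fromℚ (ℚ.1/ fromℤ z)))
      (≈ᶜ-trans (ofReal-* (fromℚ (fromℤ z)) (fromℚ (ℚ.1/ fromℤ z)))
        (SqrtLaws.ofReal-cong (fromℚ-* (fromℤ z) (ℚ.1/ fromℤ z) (ℚ.*-inverseʳ (fromℤ z)))))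
      where instance _ = fromℤ-nonZero z z≢0

√-unit : ∀ z → z ≢ 0ℤ → Unit (√ z)
√-unit z z≢0 = unit (√ z *ᶜ proj₁ z⁻¹)
  (≈ᶜ-trans (≈ᶜ-sym (*ᶜ-assoc (√ z) (√ z) (proj₁ z⁻¹)))
    (≈ᶜ-trans (*ᶜ-congʳ (proj₁ (√-isPrincipalSqrt z))) (proj₂ (proj₂ z⁻¹))))
  where
  open UnitLaws
  open CommutativeRing ℂ-commutativeRing
    using () renaming (trans to ≈ᶜ-trans; sym to ≈ᶜ-sym; *-assoc to *ᶜ-assoc; *-congʳ to *ᶜ-congʳ)
  z⁻¹ = ofℤ-unit z z≢0

√-neg-unit : ∀ s → s ≢ 0ℤ → Unit (√ (ℤ.- s))
√-neg-unit s s≢0 = √-unit (ℤ.- s) λ e → s≢0 (ℤ.neg-injective e)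

y : (r s : ℤ) → s ≢ 0ℤ → ℂ
y r s s≢0 = ofℤ r / √ (ℤ.- s) [ √-neg-unit s s≢0 ]

GSml : (r s : ℤ) → s ≢ 0ℤ → (m l : ℕ) → Series
GSml r s s≢0 m l n = S (+ (m ℕ.* n ℕ.+ l)) (y r s s≢0)

H01 : (r s : ℤ) → ℕ → ℤ
H01 r s zero          = + 0
H01 r s (suc zero)    = + 1
H01 r s (suc (suc n)) = r ℤ.* H01 r s (suc n) ℤ.+ s ℤ.* H01 r s n

GH01ml : (r s : ℤ) (m k : ℕ) → Series
GH01ml r s m k n = ofℤ (H01 r s (m ℕ.* n ℕ.+ k))

{-# OPTIONS --safe #-}

-- Put w = √(-s) and v = 1/w, so that v² s = -1 and y = r v.  Multiplying the
-- recurrence of H01 by powers of v turns it into that of S, whence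
-- S(n, y) = vⁿ H01(n+1); the first equality is this with exponent m n + l.
-- The second equality holds because S(m n + l, y) satisfies in n the recurrence
-- of order two S(j+m) + S(j-m) = R(m) S(j), and because a quotient of power
-- series by a series with invertible constant term is unique.
module Submission where

open import Algebra.Bundles using (CommutativeRing)
import Algebra.Properties.AbelianGroup as AbelianGroupProperties
import Algebra.Properties.CommutativeSemigroup as CommutativeSemigroupProperties
import Algebra.Properties.Ring as RingProperties
import Algebra.Properties.Semiring.Exp as ExpProperties
import Data.Integer as ℤ
import Data.Integer.Properties as ℤ
import Data.Nat as ℕ
import Data.Nat.Properties as ℕ
open import Data.List using ([]; _∷_)
open import Data.Nat using (ℕ; suc)
open import Data.Product using (_,_; proj₁; proj₂)
import Data.Rational as ℚ
import Data.Rational.Properties as ℚ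
import Data.Rational.Unnormalised as ℚᵘ
import Data.Rational.Unnormalised.Properties as ℚᵘ
open import Data.Rational.Literals using (fromℤ)
open import Level using (0ℓ)
import Relation.Binary.Reasoning.Setoid as SetoidReasoning
open import Relation.Binary.PropositionalEquality as ≡ using (_≡_)
import Defs

-- Rearrangements of differences in a commutative ring.

module Subtraction (K : CommutativeRing 0ℓ 0ℓ) where
  open CommutativeRing K
  open AbelianGroupProperties +-abelianGroup using (⁻¹-∙-comm; ⁻¹-anti-homo‿-; xyx⁻¹≈y)
  open CommutativeSemigroupProperties +-commutativeSemigroup using (interchange)

  [a+b]-[c+d]≈[a-c]+[b-d] : ∀ a b c d → (a + b) - (c + d) ≈ (a - c) + (b - d)
  [a+b]-[c+d]≈[a-c]+[b-d] a b c d =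
    trans (+-congˡ (sym (⁻¹-∙-comm c d))) (interchange a b (- c) (- d))

  [a-b]-[c-d]≈[a-c]-[b-d] : ∀ a b c d → (a - b) - (c - d) ≈ (a - c) - (b - d)
  [a-b]-[c-d]≈[a-c]-[b-d] a b c d =
    trans ([a+b]-[c+d]≈[a-c]+[b-d] a (- b) c (- d)) (+-congˡ (⁻¹-∙-comm b (- d)))

  a-[a-b]≈b : ∀ a b → a - (a - b) ≈ b
  a-[a-b]≈b a b = trans (+-congˡ (⁻¹-anti-homo‿- a b))
    (trans (sym (+-assoc a b (- a))) (xyx⁻¹≈y a b))

-- Chebyshev identities over an arbitrary commutative ring.

module ChebyshevProperties (K : CommutativeRing 0ℓ 0ℓ) where
  open CommutativeRing K
  open Subtraction K
  open AbelianGroupProperties +-abelianGroup using (⁻¹-involutive; ε⁻¹≈ε)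
  open RingProperties ring using (x[y-z]≈xy-xz; [y-z]x≈yx-zx; -1*x≈-x)
  open ExpProperties semiring using (_^_)
  open Defs.Chebyshev K
  open SetoidReasoning setoid

  -- The conventions S(-1) = 0 and S(-2) = -1 are what continue the recurrence below index 0; from
  -- `n` = 2 on it is the definition of `S⁺`.
  S-shifted-rec : ∀ x n → S (ℤ.+ suc (suc n) ℤ.- ℤ.+ 2) x
                        ≈ x * S (ℤ.+ suc n ℤ.- ℤ.+ 2) x - S (ℤ.+ n ℤ.- ℤ.+ 2) x
  S-shifted-rec x 0 = sym (begin
    x * 0# - - 1#  ≈⟨ +-cong (zeroʳ x) (⁻¹-involutive 1#) ⟩
    0# + 1#        ≈⟨ +-identityˡ 1# ⟩
    1#             ∎)
  S-shifted-rec x 1 = sym (begin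
    x * 1# - 0#  ≈⟨ +-cong (*-identityʳ x) ε⁻¹≈ε ⟩
    x + 0#       ≈⟨ +-identityʳ x ⟩
    x            ∎)
  S-shifted-rec x (suc (suc n)) = refl

  -- `R` is the difference of two solutions of one linear recurrence.
  R-rec : ∀ x n → R (suc (suc n)) x ≈ x * R (suc n) x - R n x
  R-rec x n = begin
    (x * a - b) - S (ℤ.+ suc (suc n) ℤ.- ℤ.+ 2) x  ≈⟨ +-congˡ (-‿cong (S-shifted-rec x n)) ⟩
    (x * a - b) - (x * c - d)                      ≈⟨ [a-b]-[c-d]≈[a-c]-[b-d] (x * a) b (x * c) d ⟩
    (x * a - x * c) - (b - d)                      ≈⟨ +-congʳ (x[y-z]≈xy-xz x a c) ⟨
    x * (a - c) - (b - d)                          ∎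
    where
    a = S⁺ (suc n) x
    b = S⁺ n x
    c = S (ℤ.+ suc n ℤ.- ℤ.+ 2) x
    d = S (ℤ.+ n ℤ.- ℤ.+ 2) x

  -- For x = 2 cos θ this is 2 cos(mθ) sin((j+1)θ) = sin((j+m+1)θ) + sin((j-m+1)θ), divided by sin
  -- θ. The equation on `k` replaces the truncated subtraction j - m. The proof is a two-step
  -- induction on `m`.
  R*S : ∀ x m k j → m ℕ.+ k ≡ j → R m x * S⁺ j x ≈ S⁺ (m ℕ.+ j) x + S⁺ k x
  R*S x 0 k .k ≡.refl = begin
    (1# - - 1#) * S⁺ k x       ≈⟨ *-congʳ (+-congˡ (⁻¹-involutive 1#)) ⟩
    (1# + 1#) * S⁺ k x         ≈⟨ distribʳ (S⁺ k x) 1# 1# ⟩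
    1# * S⁺ k x + 1# * S⁺ k x  ≈⟨ +-cong (*-identityˡ _) (*-identityˡ _) ⟩
    S⁺ k x + S⁺ k x            ∎
  R*S x 1 k .(suc k) ≡.refl = begin
    (x - 0#) * S⁺ (suc k) x                 ≈⟨ *-congʳ (trans (+-congˡ ε⁻¹≈ε) (+-identityʳ x)) ⟩
    x * S⁺ (suc k) x                        ≈⟨ +-identityʳ _ ⟨
    x * S⁺ (suc k) x + 0#                   ≈⟨ +-congˡ (-‿inverseˡ _) ⟨
    x * S⁺ (suc k) x + (- S⁺ k x + S⁺ k x)  ≈⟨ +-assoc _ _ _ ⟨
    S⁺ (suc (suc k)) x + S⁺ k x             ∎
  R*S x (suc (suc m)) k j e = begin
    R (suc (suc m)) x * S⁺ j x                             ≈⟨ *-congʳ (R-rec x m) ⟩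
    (x * R (suc m) x - R m x) * S⁺ j x                     ≈⟨ [y-z]x≈yx-zx (S⁺ j x) _ _ ⟩
    x * R (suc m) x * S⁺ j x - R m x * S⁺ j x              ≈⟨ +-congʳ (*-assoc _ _ _) ⟩
    -- Since `j` stays fixed, lowering `m` by 1 or 2 raises `k` by as much.
    x * (R (suc m) x * S⁺ j x) - R m x * S⁺ j x            ≈⟨ +-cong (*-congˡ (R*S x (suc m) (suc k) j e₁)) (-‿cong (R*S x m (suc (suc k)) j e₂)) ⟩
    x * (p + S⁺ (suc k) x) - (q + S⁺ (suc (suc k)) x)      ≈⟨ +-congʳ (distribˡ _ _ _) ⟩
    (x * p + x * S⁺ (suc k) x) - (q + S⁺ (suc (suc k)) x)  ≈⟨ [a+b]-[c+d]≈[a-c]+[b-d] _ _ _ _ ⟩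
    (x * p - q) + (x * S⁺ (suc k) x - S⁺ (suc (suc k)) x)  ≈⟨ +-congˡ (a-[a-b]≈b _ _) ⟩
    S⁺ (suc (suc m) ℕ.+ j) x + S⁺ k x                      ∎
    where
    p = S⁺ (suc m ℕ.+ j) x
    q = S⁺ (m ℕ.+ j) x
    e₁ : suc m ℕ.+ suc k ≡ j
    e₁ = ≡.trans (≡.cong suc (ℕ.+-suc m k)) e
    e₂ : m ℕ.+ suc (suc k) ≡ j
    e₂ = ≡.trans (ℕ.+-suc m (suc k)) e₁

  -- This is `R*S` with j = m(n+1) + l and k = mn + l, which differ by `m`.
  S-progression-rec : ∀ x m l n →
    S⁺ (m ℕ.* suc (suc n) ℕ.+ l) x + S⁺ (m ℕ.* n ℕ.+ l) x ≈ R m x * S⁺ (m ℕ.* suc n ℕ.+ l) x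
  S-progression-rec x m l n = begin
    S⁺ (m ℕ.* suc (suc n) ℕ.+ l) x + S⁺ (m ℕ.* n ℕ.+ l) x    ≡⟨ ≡.cong (λ i → S⁺ i x + S⁺ (m ℕ.* n ℕ.+ l) x) (step (suc n)) ⟨
    S⁺ (m ℕ.+ (m ℕ.* suc n ℕ.+ l)) x + S⁺ (m ℕ.* n ℕ.+ l) x  ≈⟨ R*S x m (m ℕ.* n ℕ.+ l) _ (step n) ⟨
    R m x * S⁺ (m ℕ.* suc n ℕ.+ l) x                         ∎
    where
    step : ∀ i → m ℕ.+ (m ℕ.* i ℕ.+ l) ≡ m ℕ.* suc i ℕ.+ l
    step i = ≡.trans (≡.sym (ℕ.+-assoc m (m ℕ.* i) l)) (≡.cong (ℕ._+ l) (≡.sym (ℕ.*-suc m i)))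

  -- Square roots enter only through `v * v * s ≈ - 1#`, so the rescaling is pure ring algebra, by
  -- two-step induction.
  S-rescale : ∀ (H : ℕ → Carrier) r s v → H 0 ≈ 0# → H 1 ≈ 1# →
    (∀ n → H (suc (suc n)) ≈ r * H (suc n) + s * H n) → v * v * s ≈ - 1# →
    ∀ n → S⁺ n (r * v) ≈ v ^ n * H (suc n)
  S-rescale H r s v H0 H1 H-rec vvs = go
    where
    open CommutativeSemigroupProperties *-commutativeSemigroup using (interchange)

    -- In the recurrence of `H`, two factors `v` combine with `s` into -1 (`low`), and one factor
    -- `v` combines with `r` into `r * v` (`high`).
    low : ∀ n → v ^ suc (suc n) * (s * H (suc n)) ≈ - (v ^ n * H (suc n))
    low n = begin
      v * (v * v ^ n) * (s * H (suc n))  ≈⟨ *-congʳ (*-assoc v v (v ^ n)) ⟨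
      v * v * v ^ n * (s * H (suc n))    ≈⟨ interchange (v * v) (v ^ n) s (H (suc n)) ⟩
      v * v * s * (v ^ n * H (suc n))    ≈⟨ *-congʳ vvs ⟩
      - 1# * (v ^ n * H (suc n))         ≈⟨ -1*x≈-x _ ⟩
      - (v ^ n * H (suc n))              ∎

    high : ∀ n h → v ^ suc n * (r * h) ≈ r * v * (v ^ n * h)
    high n h = trans (interchange v (v ^ n) r h) (*-congʳ (*-comm v r))

    go : ∀ n → S⁺ n (r * v) ≈ v ^ n * H (suc n)
    go 0 = sym (trans (*-identityˡ (H 1)) H1)
    go 1 = sym (begin
      v ^ 1 * H 2             ≈⟨ *-congˡ (trans (H-rec 0) (+-congˡ (trans (*-congˡ H0) (zeroʳ s)))) ⟩
      v ^ 1 * (r * H 1 + 0#)  ≈⟨ *-congˡ (+-identityʳ _) ⟩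
      v ^ 1 * (r * H 1)       ≈⟨ high 0 (H 1) ⟩
      r * v * (1# * H 1)      ≈⟨ *-congˡ (trans (*-identityˡ (H 1)) H1) ⟩
      r * v * 1#              ≈⟨ *-identityʳ (r * v) ⟩
      r * v                   ∎)
    go (suc (suc n)) = begin
      r * v * S⁺ (suc n) (r * v) - S⁺ n (r * v)                                    ≈⟨ +-cong (*-congˡ (go (suc n))) (-‿cong (go n)) ⟩
      r * v * (v ^ suc n * H (suc (suc n))) - v ^ n * H (suc n)                    ≈⟨ +-cong (high (suc n) _) (low n) ⟨
      v ^ suc (suc n) * (r * H (suc (suc n))) + v ^ suc (suc n) * (s * H (suc n))  ≈⟨ distribˡ _ _ _ ⟨
      v ^ suc (suc n) * (r * H (suc (suc n)) + s * H (suc n))                      ≈⟨ *-congˡ (H-rec (suc n)) ⟨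
      v ^ suc (suc n) * H (suc (suc (suc n)))                                      ∎

-- Quotients of power series and recurrences of order two.

module SeriesProperties (K : CommutativeRing 0ℓ 0ℓ) where
  open CommutativeRing K
  open AbelianGroupProperties +-abelianGroup using (xyx⁻¹≈y)
  open Defs.Division K
  open Defs.PowerSeries K
  open SetoidReasoning setoid

  -- The induction follows long division: the constant coefficient of `F` is forced, and the shifted
  -- `F` times `G` is the shifted remainder, so `F` and `P` vary while `G` stays.
  ÷-unique : ∀ (F P G : Series) (u : Unit (G 0)) → F ⊛ G ≈ₛ P → F ≈ₛ P ÷ G [ u ]
  ÷-unique F P G (g , _ , p) h 0 = begin
    F 0                   ≈⟨ *-identityʳ (F 0) ⟨
    F 0 * 1#              ≈⟨ *-congˡ p ⟨
    F 0 * (G 0 * g)       ≈⟨ *-assoc _ _ _ ⟨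
    F 0 * G 0 * g         ≈⟨ *-congʳ (+-identityʳ _) ⟨
    (F 0 * G 0 + 0#) * g  ≈⟨ *-congʳ (h 0) ⟩
    P 0 * g               ∎
  ÷-unique F P G u h (suc n) = ÷-unique (λ k → F (suc k)) _ G u tail n
    where
    tail : (λ k → F (suc k)) ⊛ G ≈ₛ λ k → P (suc k) - P 0 * proj₁ u * G (suc k)
    tail k = begin
      -- The convolution at `suc k` unfolds to its first term `F 0 * G (suc k)` plus `X`.
      X                                      ≈⟨ xyx⁻¹≈y (F 0 * G (suc k)) X ⟨
      F 0 * G (suc k) + X - F 0 * G (suc k)  ≈⟨ +-cong (h (suc k)) (-‿cong (*-congʳ (÷-unique F P G u h 0))) ⟩
      P (suc k) - P 0 * proj₁ u * G (suc k)  ∎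
      where X = ((λ i → F (suc i)) ⊛ G) k

  -- Past degree two the factor paired with `F 0` is 0, so `F` can be shifted until only three terms
  -- remain.
  ⊛-quadratic : ∀ F a b c n → (F ⊛ polynomial (a ∷ b ∷ c ∷ [])) (suc (suc n))
                            ≈ F n * c + (F (suc n) * b + F (suc (suc n)) * a)
  ⊛-quadratic F a b c 0 = +-congˡ (+-congˡ (+-identityʳ _))
  ⊛-quadratic F a b c (suc n) = trans (+-congʳ (zeroʳ (F 0)))
    (trans (+-identityˡ _) (⊛-quadratic (λ k → F (suc k)) a b c n))

  -- In the product of `F` with 1 - t x + x², the recurrence kills every coefficient from degree two
  -- on; degrees 0 and 1 give the numerator.
  order-two-generating-function : ∀ F t → (∀ n → F (suc (suc n)) + F n ≈ t * F (suc n)) →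
    F ≈ₛ polynomial (F 0 ∷ - (F 0 * t - F 1) ∷ []) ÷ polynomial (1# ∷ - t ∷ 1# ∷ []) [ unit-1 ]
  order-two-generating-function F t rec = ÷-unique F _ _ unit-1 product
    where
    open AbelianGroupProperties +-abelianGroup using (⁻¹-anti-homo‿-)
    open RingProperties ring using (-‿distribʳ-*)

    product : F ⊛ polynomial (1# ∷ - t ∷ 1# ∷ []) ≈ₛ polynomial (F 0 ∷ - (F 0 * t - F 1) ∷ [])
    product 0 = trans (+-identityʳ _) (*-identityʳ (F 0))
    product 1 = begin
      F 0 * - t + (F 1 * 1# + 0#)  ≈⟨ +-cong (sym (-‿distribʳ-* (F 0) t)) (trans (+-identityʳ _) (*-identityʳ (F 1))) ⟩
      - (F 0 * t) + F 1            ≈⟨ +-comm _ _ ⟩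
      F 1 - F 0 * t                ≈⟨ ⁻¹-anti-homo‿- (F 0 * t) (F 1) ⟨
      - (F 0 * t - F 1)            ∎
    product (suc (suc n)) = begin
      (F ⊛ polynomial (1# ∷ - t ∷ 1# ∷ [])) (suc (suc n))  ≈⟨ ⊛-quadratic F 1# (- t) 1# n ⟩
      F n * 1# + (F (suc n) * - t + F (suc (suc n)) * 1#)  ≈⟨ +-cong (*-identityʳ _) (trans (+-congˡ (*-identityʳ _)) (+-comm _ _)) ⟩
      F n + (F (suc (suc n)) + F (suc n) * - t)            ≈⟨ +-assoc _ _ _ ⟨
      F n + F (suc (suc n)) + F (suc n) * - t              ≈⟨ +-cong (+-comm _ _) (sym (-‿distribʳ-* (F (suc n)) t)) ⟩
      F (suc (suc n)) + F n - F (suc n) * t                ≈⟨ +-cong (rec n) (-‿cong (*-comm (F (suc n)) t)) ⟩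
      t * F (suc n) - t * F (suc n)                        ≈⟨ -‿inverseʳ _ ⟩
      0#                                                   ∎

open import Defs
open import Data.Nat using (_+_; _≤_; _<_)
open import Data.Integer using (ℤ; +_; -_; 0ℤ)
open import Data.Product using (_×_)
open import Relation.Binary.PropositionalEquality using (_≢_)

-- The embedding of ℤ into ℂ as a ring homomorphism.

-- Addition in ℚ normalises; on unnormalised fractions all denominators are 1 and only factors of 1
-- must be removed.
fromℤ-+ : ∀ a b → fromℤ (a ℤ.+ b) ≡ fromℤ a ℚ.+ fromℤ b
fromℤ-+ a b = ℚ.toℚᵘ-injective (ℚᵘ.≃-sym (ℚᵘ.≃-trans (ℚ.toℚᵘ-homo-+ (fromℤ a) (fromℤ b))
  (ℚᵘ.*≡* (≡.cong (ℤ._* + 1) (≡.cong₂ ℤ._+_ (ℤ.*-identityʳ a) (ℤ.*-identityʳ b))))))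

fromℤ-* : ∀ a b → fromℤ (a ℤ.* b) ≡ fromℤ a ℚ.* fromℤ b
fromℤ-* a b = ℚ.toℚᵘ-injective (ℚᵘ.≃-sym (ℚ.toℚᵘ-homo-* (fromℤ a) (fromℤ b)))

opaque
  unfolding _+ᴿ_

  -- Once unfolded, both sides are the same constant sequence, so any ε is met from index 0.
  fromℚ-+ : ∀ p q → fromℚ (p ℚ.+ q) ≈ᴿ fromℚ p +ᴿ fromℚ q
  fromℚ-+ p q = mk≈ λ ε ε>0 → 0 , λ _ _ →
    ≡.subst (λ z → ℚ.∣ z ∣ ℚ.< ε) (≡.sym (ℚ.+-inverseʳ (p ℚ.+ q))) ε>0

  fromℚ-* : ∀ p q → fromℚ (p ℚ.* q) ≈ᴿ fromℚ p *ᴿ fromℚ q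
  fromℚ-* p q = mk≈ λ ε ε>0 → 0 , λ _ _ →
    ≡.subst (λ z → ℚ.∣ z ∣ ℚ.< ε) (≡.sym (ℚ.+-inverseʳ (p ℚ.* q))) ε>0

module ℝ-ring = CommutativeRing ℝ-commutativeRing
module ℂ-ring = CommutativeRing ℂ-commutativeRing

ofℤ-+ : ∀ a b → ofℤ (a ℤ.+ b) ≈ᶜ ofℤ a +ᶜ ofℤ b
ofℤ-+ a b = mk≈ᶜ
  (≡.subst (λ q → fromℚ q ≈ᴿ fromℚ (fromℤ a) +ᴿ fromℚ (fromℤ b)) (≡.sym (fromℤ-+ a b)) (fromℚ-+ (fromℤ a) (fromℤ b)))
  (ℝ-ring.sym (ℝ-ring.+-identityʳ 0ᴿ))

ofℤ-* : ∀ a b → ofℤ (a ℤ.* b) ≈ᶜ ofℤ a *ᶜ ofℤ b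
ofℤ-* a b = ℂ-ring.trans (mk≈ᶜ
  (≡.subst (λ q → fromℚ q ≈ᴿ fromℚ (fromℤ a) *ᴿ fromℚ (fromℤ b)) (≡.sym (fromℤ-* a b)) (fromℚ-* (fromℤ a) (fromℤ b)))
  ℝ-ring.refl) (ℂ-ring.sym (ofReal-* (fromℚ (fromℤ a)) (fromℚ (fromℤ b))))

ofℤ-H01-rec : ∀ r s n → ofℤ (H01 r s (suc (suc n)))
                      ≈ᶜ ofℤ r *ᶜ ofℤ (H01 r s (suc n)) +ᶜ ofℤ s *ᶜ ofℤ (H01 r s n)
ofℤ-H01-rec r s n = ℂ-ring.trans (ofℤ-+ (r ℤ.* H01 r s (suc n)) (s ℤ.* H01 r s n))
  (ℂ-ring.+-cong (ofℤ-* r (H01 r s (suc n))) (ofℤ-* s (H01 r s n)))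

-- The inverse of √(-s) and its powers.

-- Writing 1 as (v w)² gives v² s + 1 = v² (s + w²), which vanishes because w² = -s.
1/√-s-square : ∀ s (u : Unit (√ (- s))) → proj₁ u *ᶜ proj₁ u *ᶜ ofℤ s ≈ᶜ -ᶜ 1ᶜ
1/√-s-square s (v , vw≈1 , _) = inverseˡ-unique (v *ᶜ v *ᶜ ofℤ s) 1ᶜ (begin
  v *ᶜ v *ᶜ ofℤ s +ᶜ 1ᶜ                   ≈⟨ ℂ-ring.+-congˡ (ℂ-ring.*-identityˡ 1ᶜ) ⟨
  v *ᶜ v *ᶜ ofℤ s +ᶜ 1ᶜ *ᶜ 1ᶜ             ≈⟨ ℂ-ring.+-congˡ (ℂ-ring.*-cong vw≈1 vw≈1) ⟨
  v *ᶜ v *ᶜ ofℤ s +ᶜ v *ᶜ w *ᶜ (v *ᶜ w)   ≈⟨ ℂ-ring.+-congˡ (interchange v w v w) ⟩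
  v *ᶜ v *ᶜ ofℤ s +ᶜ v *ᶜ v *ᶜ (w *ᶜ w)   ≈⟨ ℂ-ring.+-congˡ (ℂ-ring.*-congˡ (proj₁ (√-isPrincipalSqrt (- s)))) ⟩
  v *ᶜ v *ᶜ ofℤ s +ᶜ v *ᶜ v *ᶜ ofℤ (- s)  ≈⟨ ℂ-ring.distribˡ (v *ᶜ v) (ofℤ s) (ofℤ (- s)) ⟨
  v *ᶜ v *ᶜ (ofℤ s +ᶜ ofℤ (- s))          ≈⟨ ℂ-ring.*-congˡ (ofℤ-+ s (- s)) ⟨
  v *ᶜ v *ᶜ ofℤ (s ℤ.- s)                 ≡⟨ ≡.cong (λ z → v *ᶜ v *ᶜ ofℤ z) (ℤ.+-inverseʳ s) ⟩
  v *ᶜ v *ᶜ 0ᶜ                            ≈⟨ ℂ-ring.zeroʳ (v *ᶜ v) ⟩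
  0ᶜ                                      ∎)
  where
  open AbelianGroupProperties ℂ-ring.+-abelianGroup using (inverseˡ-unique)
  open CommutativeSemigroupProperties ℂ-ring.*-commutativeSemigroup using (interchange)
  open SetoidReasoning ℂ-ring.setoid
  w = √ (- s)

-- The witness in `unit-^` is built by the same recursion as the power of the inverse.
unit-^-inverse : ∀ {w} (u : Unit w) n → 1ᶜ / w ^ n [ unit-^ u n ] ≈ᶜ proj₁ u ^ n
unit-^-inverse u n = ℂ-ring.trans (ℂ-ring.*-identityˡ _) (inverse n)
  where
  inverse : ∀ n → proj₁ (unit-^ u n) ≈ᶜ proj₁ u ^ n
  inverse 0       = ℂ-ring.refl
  inverse (suc n) = ℂ-ring.*-congˡ (inverse n)

-- The two forms of the generating function.

mainTheorem1 : (r s : ℤ) → r ≢ 0ℤ → (s≢0 : s ≢ 0ℤ) →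
    (m : ℕ) → 1 ≤ m → (l : ℕ) → l < m →
    let w = √ (- s)
        w-unit = √-neg-unit s s≢0
        Y = y r s s≢0
        numerator = S (+ l) Y ∷ -ᶜ (S (+ l) Y *ᶜ R m Y -ᶜ S (+ (m + l)) Y) ∷ []
        denominator = 1ᶜ ∷ -ᶜ R m Y ∷ 1ᶜ ∷ []
    in (GSml r s s≢0 m l
          ≈ₛ (1ᶜ / w ^ l [ unit-^ w-unit l ]) · (GH01ml r s m (l + 1) ⟨ 1ᶜ / w ^ m [ unit-^ w-unit m ] ·x⟩))
       × (GSml r s s≢0 m l
          ≈ₛ polynomial numerator ÷ polynomial denominator [ unit-1 ])
mainTheorem1 r s _ s≢0 m _ l _ = first , second
  where
  open ChebyshevProperties ℂ-commutativeRing using (S-rescale; S-progression-rec)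
  open SeriesProperties ℂ-commutativeRing using (order-two-generating-function)
  open ExpProperties ℂ-ring.semiring using (^-homo-*; ^-assocʳ; ^-congˡ)
  open SetoidReasoning ℂ-ring.setoid

  w = √ (- s)
  u = √-neg-unit s s≢0
  v = proj₁ u
  Y = y r s s≢0

  S⁺≈v^nH01 : ∀ n → S (+ n) Y ≈ᶜ v ^ n *ᶜ ofℤ (H01 r s (suc n))
  S⁺≈v^nH01 = S-rescale (λ n → ofℤ (H01 r s n)) (ofℤ r) (ofℤ s) v
    ℂ-ring.refl ℂ-ring.refl (ofℤ-H01-rec r s) (1/√-s-square s u)

  first : GSml r s s≢0 m l
    ≈ₛ (1ᶜ / w ^ l [ unit-^ u l ]) · (GH01ml r s m (l + 1) ⟨ 1ᶜ / w ^ m [ unit-^ u m ] ·x⟩)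
  first n = begin
    S (+ (m ℕ.* n + l)) Y                                   ≈⟨ S⁺≈v^nH01 (m ℕ.* n + l) ⟩
    v ^ (m ℕ.* n + l) *ᶜ ofℤ (H01 r s (suc (m ℕ.* n + l)))  ≡⟨ ≡.cong (λ i → v ^ (m ℕ.* n + l) *ᶜ ofℤ (H01 r s i)) index ⟩
    v ^ (m ℕ.* n + l) *ᶜ h                                  ≈⟨ ℂ-ring.*-congʳ (^-homo-* v (m ℕ.* n) l) ⟩
    v ^ (m ℕ.* n) *ᶜ v ^ l *ᶜ h                             ≈⟨ ℂ-ring.*-congʳ (ℂ-ring.*-comm (v ^ (m ℕ.* n)) (v ^ l)) ⟩
    v ^ l *ᶜ v ^ (m ℕ.* n) *ᶜ h                             ≈⟨ ℂ-ring.*-assoc (v ^ l) (v ^ (m ℕ.* n)) h ⟩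
    -- The power (v^m)^n is the factor that substituting x / w^m puts on the coefficient of x^n.
    v ^ l *ᶜ (v ^ (m ℕ.* n) *ᶜ h)                           ≈⟨ ℂ-ring.*-congˡ (ℂ-ring.*-congʳ (^-assocʳ v m n)) ⟨
    v ^ l *ᶜ ((v ^ m) ^ n *ᶜ h)                             ≈⟨ ℂ-ring.*-cong (unit-^-inverse u l)
                                                                   (ℂ-ring.*-congʳ (^-congˡ n (unit-^-inverse u m))) ⟨
    (1ᶜ / w ^ l [ unit-^ u l ]) *ᶜ ((1ᶜ / w ^ m [ unit-^ u m ]) ^ n *ᶜ h)  ∎
    where
    h = ofℤ (H01 r s (m ℕ.* n + (l + 1)))
    index : suc (m ℕ.* n + l) ≡ m ℕ.* n + (l + 1)
    index = ≡.trans (≡.sym (ℕ.+-suc (m ℕ.* n) l)) (≡.cong (λ i → m ℕ.* n + i) (≡.sym (ℕ.+-comm l 1)))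

  second : GSml r s s≢0 m l
    ≈ₛ polynomial (S (+ l) Y ∷ -ᶜ (S (+ l) Y *ᶜ R m Y -ᶜ S (+ (m + l)) Y) ∷ [])
       ÷ polynomial (1ᶜ ∷ -ᶜ R m Y ∷ 1ᶜ ∷ []) [ unit-1 ]
  -- The first two coefficients carry the indices `m ℕ.* 0 + l` and `m ℕ.* 1 + l`, which do not
  -- reduce to `l` and `m + l` for a variable `m`; hence the transport.
  second = ≡.subst₂
    (λ i j → GSml r s s≢0 m l
      ≈ₛ polynomial (S (+ i) Y ∷ -ᶜ (S (+ i) Y *ᶜ R m Y -ᶜ S (+ j) Y) ∷ [])
         ÷ polynomial (1ᶜ ∷ -ᶜ R m Y ∷ 1ᶜ ∷ []) [ unit-1 ])
    (≡.cong (_+ l) (ℕ.*-zeroʳ m)) (≡.cong (_+ l) (ℕ.*-identityʳ m))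
    (order-two-generating-function (GSml r s s≢0 m l) (R m Y) (S-progression-rec Y m l))
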